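{- Let $n$ be an odd positive integer, and let $a,b$ be distinct integers with $0<a,b<n$, $b$ odd and $a$ even, such that $G=C_{2n}(a,b,n)$ is a connected $5$-regular circulant graph. Then $G$ admits a factorization (in the sense described in the context) as a Cartesian product of a $3$-regular circulant graph and a $2$-regular circulant graph if and only if there exist positive integers $p,q$ with $p>2$, $1<q<n$, $p\mid a$, $q\mid b$, $pq=2n$ and $\gcd(p,q)=1$.
   Context: For an integer $m$ and a set $R$ of positive integers each at most $m/2$, the circulant graph $C_m(R)$ has vertex set $\{0,1,\dots,m-1\}$, with $i$ and $j$ adjacent iff $\min(|i-j|,\,m-|i-j|)\in R$; it is regular of degree $2|R|$ if $m/2\notin R$ and of degree $2|R|-1$ if $m/2\in R$. $C_{2n}(a,b,n)$ denotes the circulant graph on $2n$ vertices with jump set $\{a,b,n\}$. The Cartesian product $G_1\square G_2$ has vertex set $V(G_1)\times V(G_2)$, with $(u_1,v_1)\sim(u_2,v_2)$ iff either $u_1=u_2$ and $v_1v_2\in E(G_2)$, or $v_1=v_2$ and $u_1u_2\in E(G_1)$. The factorization theorem for circulant graphs states: if $p,q$ are relatively prime, $R\subseteq[1,p/2]$, $S\subseteq[1,q/2]$ and $T=qR\cup pS$ (where $qR=\{qr:r\in R\}$, $pS=\{ps:s\in S\}$), then $C_{pq}(T)\cong C_p(R)\square C_q(S)$. "$G=C_{2n}(a,b,n)$ admits a factorization as a Cartesian product of a $3$-regular and a $2$-regular circulant graph" means: there exist relatively prime integers $p,q>1$ with $pq=2n$ and sets of integers $R\subseteq[1,p/2]$,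 $S\subseteq[1,q/2]$ with $qR\cup pS=\{a,b,n\}$, such that $C_p(R)$ is $3$-regular and $C_q(S)$ is $2$-regular (so that $G\cong C_p(R)\square C_q(S)$ by the factorization theorem). -}

module Defs where

open import Data.Fin.Base using (Fin; toℕ)
open import Data.List.Base using (List; _++_; allFin; filter; length; map)
open import Data.List.Membership.DecPropositional using (_∈?_)
open import Data.List.Membership.Propositional using (_∈_)
open import Data.List.Relation.Binary.BagAndSetEquality using (_∼[_]_; set)
open import Data.List.Relation.Unary.All using (All)
open import Data.Nat.Base using (ℕ; _*_; _∸_; _⊓_; _<_; _≤_; ∣_-_∣)
open import Data.Nat.Coprimality using (Coprime)
open import Data.Nat.Properties using (_≟_)
open import Data.Product.Base using (_×_; ∃-syntax)
open import Level using (0ℓ)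
open import Relation.Binary.Construct.Closure.ReflexiveTransitive using (Star)
open import Relation.Binary.Core using (Rel)
open import Relation.Binary.Definitions using (Decidable)
open import Relation.Binary.PropositionalEquality.Core using (_≡_)

-- Finite sets of jumps are represented by lists, read up to set equality:
-- order and repetitions are irrelevant.

JumpSet : ℕ → List ℕ → Set
JumpSet m R = All (λ r → 1 ≤ r × 2 * r ≤ m) R

-- Adjacency in C_m(R).  It is irreflexive when 0 ∉ R, in particular
-- when JumpSet m R holds.

circDist : (m : ℕ) → Fin m → Fin m → ℕ
circDist m i j = ∣ toℕ i - toℕ j ∣ ⊓ (m ∸ ∣ toℕ i - toℕ j ∣)

Adj : (m : ℕ) → List ℕ → Rel (Fin m) 0ℓ
Adj m R i j = circDist m i j ∈ R

adj? : (m : ℕ) (R : List ℕ) → Decidable (Adj m R)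
adj? m R i j = _∈?_ _≟_ (circDist m i j) R

degree : (m : ℕ) → List ℕ → Fin m → ℕ
degree m R i = length (filter (adj? m R i) (allFin m))

Regular : ℕ → (m : ℕ) → List ℕ → Set
Regular d m R = (i : Fin m) → degree m R i ≡ d

Connected : (m : ℕ) → List ℕ → Set
Connected m R = (i j : Fin m) → Star (Adj m R) i j

-- C_m(T) factors, via T = qR ∪ pS with m = pq, as the Cartesian product of
-- a d-regular C_p(R) and an e-regular C_q(S).

AdmitsFactorization : (m : ℕ) → List ℕ → (d e : ℕ) → Set
AdmitsFactorization m T d e =
  ∃[ p ] ∃[ q ] ∃[ R ] ∃[ S ]
    ( 1 < p × 1 < q × Coprime p q × p * q ≡ m
    × JumpSet p R × JumpSet q S
    × (map (q *_) R ++ map (p *_) S) ∼[ set ] T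
    × Regular d p R × Regular e q S )

{-# OPTIONS --safe #-}
-- Since n is odd, a is the only even number among a, b, n, and exactly one of
-- the factors p, q of 2n is even.  If q were even, then every element of qR
-- would equal a, so R would have at most one element and C_p(R) degree at
-- most 2.  Hence p is even, pS = {a} and b ∈ qR.  Conversely, R = {b/q, p/2}
-- and S = {a/p} give the factorization.
module Submission where

open import Defs
open import Data.Empty using (⊥)
open import Data.Fin.Base using (Fin; zero; toℕ; fromℕ<)
open import Data.Fin.Properties using (toℕ-injective; toℕ-fromℕ<; toℕ<n; toℕ≤n)
open import Data.List.Base using (List; []; _∷_; _++_; allFin; filter; length; map)
open import Data.List.Membership.Propositional using (_∈_)
open import Data.List.Membership.Propositional.Properties
  using (∈-map⁺; ∈-map⁻; ∈-++⁺ˡ; ∈-++⁺ʳ; ∈-++⁻; ∈-filter⁺; ∈-filter⁻; ∈-allFin)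
open import Data.List.Membership.Propositional.Properties.WithK using (unique∧set⇒bag)
open import Data.List.Properties using (length-filter; length-map; length-tabulate)
open import Data.List.Relation.Binary.BagAndSetEquality using (∼bag⇒↭)
open import Data.List.Relation.Binary.Permutation.Propositional.Properties using (↭-length)
open import Data.List.Relation.Unary.All using ([]; _∷_)
open import Data.List.Relation.Unary.AllPairs using ([]; _∷_)
open import Data.List.Relation.Unary.Any using (here; there)
open import Data.List.Relation.Unary.Unique.Propositional using (Unique)
open import Data.List.Relation.Unary.Unique.Propositional.Properties using (map⁺; filter⁺; allFin⁺)
open import Data.Nat.Base using (ℕ; zero; suc; _+_; _*_; _∸_; _⊓_; _≤_; _<_; _>_; ∣_-_∣; NonZero; >-nonZero; s≤s; z≤n)
open import Data.Nat.Coprimality using (coprime⇒gcd≡1; gcd≡1⇒coprime)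
open import Data.Nat.Divisibility using (_∣_; _∤_; divides; m∣m*n; ∣-trans)
open import Data.Nat.DivMod using (_%_; _mod_; %-distribˡ-+; m%n%n≡m%n; m%n<n; [m+n]%n≡m%n; m<n⇒m%n≡m)
open import Data.Nat.GCD using (gcd)
open import Data.Nat.Primality using (prime[2]; euclidsLemma)
open import Data.Nat.Properties
open import Data.Product.Base using (_×_; _,_; ∃-syntax; proj₂)
open import Data.Sum.Base using (_⊎_; inj₁; inj₂)
open import Function.Bundles using (_⇔_; mk⇔; Equivalence)
open import Relation.Binary.PropositionalEquality
open import Relation.Nullary using (yes; no; contradiction)

private
  variable
    m r d : ℕ
    R : List ℕ

-- Circular distance from 0 of a single residue.

fold : ℕ → ℕ → ℕ
fold m x = x ⊓ (m ∸ x)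

fold-reflect : r ≤ m → fold m (m ∸ r) ≡ fold m r
fold-reflect {r} {m} r≤m = begin
  (m ∸ r) ⊓ (m ∸ (m ∸ r)) ≡⟨ cong ((m ∸ r) ⊓_) (m∸[m∸n]≡n r≤m) ⟩
  (m ∸ r) ⊓ r             ≡⟨ ⊓-comm (m ∸ r) r ⟩
  r ⊓ (m ∸ r)             ∎
  where open ≡-Reasoning

2*r≤m⇒r≤m∸r : 2 * r ≤ m → r ≤ m ∸ r
2*r≤m⇒r≤m∸r {r} {m} 2r≤m =
  m+n≤o⇒m≤o∸n r (subst (_≤ m) (cong (r +_) (+-identityʳ r)) 2r≤m)

fold-small : 2 * r ≤ m → fold m r ≡ r
fold-small 2r≤m = m≤n⇒m⊓n≡m (2*r≤m⇒r≤m∸r 2r≤m)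

-- A minimum equals one of its two arguments. This is why one jump accounts for at most two
-- neighbours of a vertex.
fold⁻ : ∀ {x} → x ≤ m → fold m x ≡ r → x ≡ r ⊎ x ≡ m ∸ r
fold⁻ {m} {r} {x} x≤m eq with ⊓-sel x (m ∸ x)
... | inj₁ p = inj₁ (trans (sym p) eq)
... | inj₂ p = inj₂ (trans (sym (m∸[m∸n]≡n x≤m)) (cong (m ∸_) (trans (sym p) eq)))

-- Rotations and the neighbourhood of a vertex.

module _ .{{_ : NonZero m}} where

  -- The shift is a natural number rather than a residue, so that `m ∸ toℕ i` is a legitimate shift
  -- even when `toℕ i` is 0.
  rotate : ℕ → Fin m → Fin m
  rotate x j = (x + toℕ j) mod m

  toℕ-rotate : ∀ x j → toℕ (rotate x j) ≡ (x + toℕ j) % m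
  toℕ-rotate x j = toℕ-fromℕ< (m%n<n (x + toℕ j) m)

  rotate-inverse : ∀ x y → x + y ≡ m → ∀ j → rotate x (rotate y j) ≡ j
  rotate-inverse x y x+y≡m j = toℕ-injective (begin
    toℕ (rotate x (rotate y j))           ≡⟨ toℕ-rotate x (rotate y j) ⟩
    (x + toℕ (rotate y j)) % m            ≡⟨ cong (λ z → (x + z) % m) (toℕ-rotate y j) ⟩
    (x + (y + toℕ j) % m) % m             ≡⟨ %-distribˡ-+ x _ m ⟩
    (x % m + (y + toℕ j) % m % m) % m     ≡⟨ cong (λ z → (x % m + z) % m) (m%n%n≡m%n (y + toℕ j) m) ⟩
    (x % m + (y + toℕ j) % m) % m         ≡⟨ %-distribˡ-+ x (y + toℕ j) m ⟨
    (x + (y + toℕ j)) % m                 ≡⟨ cong (_% m) (+-assoc x y (toℕ j)) ⟨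
    (x + y + toℕ j) % m                   ≡⟨ cong (λ z → (z + toℕ j) % m) x+y≡m ⟩
    (m + toℕ j) % m                       ≡⟨ cong (_% m) (+-comm m (toℕ j)) ⟩
    (toℕ j + m) % m                       ≡⟨ [m+n]%n≡m%n (toℕ j) m ⟩
    toℕ j % m                             ≡⟨ m<n⇒m%n≡m (toℕ<n j) ⟩
    toℕ j                                 ∎)
    where open ≡-Reasoning

  -- `circDist m i j` unfolds to `fold m` of the absolute difference. If `toℕ i + toℕ e` stays below
  -- `m`, that difference is `toℕ e`; otherwise it is `m ∸ toℕ e`, which `fold m` does not
  -- distinguish from `toℕ e`.
  circDist-rotate : ∀ i e → circDist m i (rotate (toℕ i) e) ≡ fold m (toℕ e)
  circDist-rotate i e with toℕ i + toℕ e <? m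
  ... | yes i+e<m = cong (fold m) (begin
    ∣ toℕ i - toℕ (rotate (toℕ i) e) ∣ ≡⟨ cong ∣ toℕ i -_∣ (trans (toℕ-rotate (toℕ i) e) (m<n⇒m%n≡m i+e<m)) ⟩
    ∣ toℕ i - toℕ i + toℕ e ∣          ≡⟨ ∣m-m+n∣≡n (toℕ i) (toℕ e) ⟩
    toℕ e                              ∎)
    where open ≡-Reasoning
  ... | no i+e≮m = trans (cong (fold m) (begin
    ∣ toℕ i - toℕ (rotate (toℕ i) e) ∣ ≡⟨ cong₂ ∣_-_∣ i≡k+[m∸e] rotate≡k ⟩
    ∣ k + (m ∸ toℕ e) - k ∣            ≡⟨ ∣-∣-comm (k + (m ∸ toℕ e)) k ⟩
    ∣ k - k + (m ∸ toℕ e) ∣            ≡⟨ ∣m-m+n∣≡n k (m ∸ toℕ e) ⟩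
    m ∸ toℕ e                          ∎)) (fold-reflect (toℕ≤n e))
    where
    open ≡-Reasoning
    k : ℕ
    k = toℕ i + toℕ e ∸ m
    k+m≡i+e : k + m ≡ toℕ i + toℕ e
    k+m≡i+e = m∸n+n≡m (≮⇒≥ i+e≮m)
    i≡k+[m∸e] : toℕ i ≡ k + (m ∸ toℕ e)
    i≡k+[m∸e] = begin
      toℕ i                   ≡⟨ m+n∸n≡m (toℕ i) (toℕ e) ⟨
      toℕ i + toℕ e ∸ toℕ e   ≡⟨ cong (_∸ toℕ e) k+m≡i+e ⟨
      k + m ∸ toℕ e           ≡⟨ +-∸-assoc k (toℕ≤n e) ⟩
      k + (m ∸ toℕ e)         ∎
    -- Both summands are below `m`, so their sum wraps around only once.
    k<m : k < m
    k<m = +-cancelʳ-< m k m (subst (_< m + m) (sym k+m≡i+e) (+-mono-< (toℕ<n i) (toℕ<n e)))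
    rotate≡k : toℕ (rotate (toℕ i) e) ≡ k
    rotate≡k = begin
      toℕ (rotate (toℕ i) e)  ≡⟨ toℕ-rotate (toℕ i) e ⟩
      (toℕ i + toℕ e) % m     ≡⟨ cong (_% m) k+m≡i+e ⟨
      (k + m) % m             ≡⟨ [m+n]%n≡m%n k m ⟩
      k % m                   ≡⟨ m<n⇒m%n≡m k<m ⟩
      k                       ∎

-- The offsets j - i mod m of the neighbours j of i do not depend on i.
regular-from-offsets : ∀ {os} → Unique os →
  (∀ {x} → x ∈ os ⇔ (x < m × fold m x ∈ R)) → Regular (length os) m R
regular-from-offsets {m@(suc _)} {R} {os} unique offsets i = begin
  length nbrs               ≡⟨ length-map offset nbrs ⟨
  length (map offset nbrs)  ≡⟨ ↭-length (∼bag⇒↭ (unique∧set⇒bag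
                                 (map⁺ offset-injective (filter⁺ (adj? m R i) (allFin⁺ m)))
                                 unique (mk⇔ to from))) ⟩
  -- Neither list has repetitions, so having the same members makes them permutations of each other.
  length os                 ∎
  where
  open ≡-Reasoning
  nbrs = filter (adj? m R i) (allFin m)
  offset : Fin m → ℕ
  offset j = toℕ (rotate (m ∸ toℕ i) j)
  rotate-back : ∀ j → rotate (toℕ i) (rotate (m ∸ toℕ i) j) ≡ j
  rotate-back = rotate-inverse (toℕ i) (m ∸ toℕ i) (m+[n∸m]≡n (toℕ≤n i))
  offset-injective : ∀ {j k} → offset j ≡ offset k → j ≡ k
  offset-injective {j} {k} eq = trans (sym (rotate-back j))
    (trans (cong (rotate (toℕ i)) (toℕ-injective eq)) (rotate-back k))
  to : ∀ {x} → x ∈ map offset nbrs → x ∈ os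
  -- Writing `j` as the rotation by `toℕ i` of its offset turns adjacency of `i` and `j` into a
  -- condition on the offset alone.
  to x∈ with j , j∈ , refl ← ∈-map⁻ offset x∈ = Equivalence.from offsets
    ( toℕ<n _
    , subst (_∈ R)
        (trans (cong (circDist m i) (sym (rotate-back j))) (circDist-rotate i _))
        (proj₂ (∈-filter⁻ (adj? m R i) {xs = allFin m} j∈)))
  from : ∀ {x} → x ∈ os → x ∈ map offset nbrs
  from {x} x∈ with x<m , fold∈R ← Equivalence.to offsets x∈ =
    subst (_∈ map offset nbrs)
      (trans (cong toℕ (rotate-inverse (m ∸ toℕ i) (toℕ i) (m∸n+n≡m (toℕ≤n i)) e)) toℕ-e)
      (∈-map⁺ offset (∈-filter⁺ (adj? m R i) (∈-allFin (rotate (toℕ i) e))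
        (subst (_∈ R) (sym (trans (circDist-rotate i e) (cong (fold m) toℕ-e))) fold∈R)))
    where
    e : Fin m
    e = fromℕ< x<m
    toℕ-e : toℕ e ≡ x
    toℕ-e = toℕ-fromℕ< x<m

-- Degrees for the two jump sets of the converse direction.

2*r<m⇒r<m∸r : 2 * r < m → r < m ∸ r
2*r<m⇒r<m∸r {r} {m} 2r<m =
  m+n≤o⇒m≤o∸n (suc r) (subst (_≤ m) (cong (λ x → suc (r + x)) (+-identityʳ r)) 2r<m)

-- The offsets are `r` and `m ∸ r`; strictness of `2 * r < m` keeps them distinct.
regular-singleton : 0 < r → 2 * r < m → Regular 2 m (r ∷ [])
regular-singleton {r} {m} 0<r 2r<m =
  regular-from-offsets ((<⇒≢ r<m∸r ∷ []) ∷ [] ∷ []) (mk⇔ to from)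
  where
  r<m∸r : r < m ∸ r
  r<m∸r = 2*r<m⇒r<m∸r 2r<m
  r<m : r < m
  r<m = <-≤-trans r<m∸r (m∸n≤m m r)
  to : ∀ {x} → x ∈ r ∷ m ∸ r ∷ [] → x < m × fold m x ∈ r ∷ []
  to (here refl) = r<m , here (fold-small (<⇒≤ 2r<m))
  to (there (here refl)) = ∸-monoʳ-< 0<r (<⇒≤ r<m) ,
    here (trans (fold-reflect (<⇒≤ r<m)) (fold-small (<⇒≤ 2r<m)))
  from : ∀ {x} → x < m × fold m x ∈ r ∷ [] → x ∈ r ∷ m ∸ r ∷ []
  from (x<m , here eq) with fold⁻ (<⇒≤ x<m) eq
  ... | inj₁ x≡r = here x≡r
  ... | inj₂ x≡m∸r = there (here x≡m∸r)

-- The jump `r` contributes a pair of opposite offsets, while `h` is its own reflection modulo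
-- `2 * h` and contributes only one.
regular-with-half : ∀ {h} → 0 < r → r < h → Regular 3 (2 * h) (r ∷ h ∷ [])
regular-with-half {r} {h} 0<r r<h =
  regular-from-offsets
    ((<⇒≢ r<2h∸r ∷ <⇒≢ r<h ∷ []) ∷ (>⇒≢ h<2h∸r ∷ []) ∷ [] ∷ []) (mk⇔ to from)
  where
  2h = 2 * h
  2h∸h≡h : 2h ∸ h ≡ h
  2h∸h≡h = trans (m+n∸m≡n h (h + 0)) (+-identityʳ h)
  h≤2h : h ≤ 2h
  h≤2h = m≤m+n h (h + 0)
  r≤2h : r ≤ 2h
  r≤2h = ≤-trans (<⇒≤ r<h) h≤2h
  2r≤2h : 2 * r ≤ 2h
  2r≤2h = *-monoʳ-≤ 2 (<⇒≤ r<h)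
  h<2h∸r : h < 2h ∸ r
  h<2h∸r = subst (_< 2h ∸ r) 2h∸h≡h (∸-monoʳ-< r<h h≤2h)
  r<2h∸r : r < 2h ∸ r
  r<2h∸r = <-trans r<h h<2h∸r
  h<2h : h < 2h
  h<2h = <-≤-trans h<2h∸r (m∸n≤m 2h r)
  to : ∀ {x} → x ∈ r ∷ 2h ∸ r ∷ h ∷ [] → x < 2h × fold 2h x ∈ r ∷ h ∷ []
  to (here refl) = <-trans r<h h<2h , here (fold-small 2r≤2h)
  to (there (here refl)) = ∸-monoʳ-< 0<r r≤2h ,
    here (trans (fold-reflect r≤2h) (fold-small 2r≤2h))
  to (there (there (here refl))) = h<2h , there (here (fold-small {h} ≤-refl))
  from : ∀ {x} → x < 2h × fold 2h x ∈ r ∷ h ∷ [] → x ∈ r ∷ 2h ∸ r ∷ h ∷ []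
  from (x<2h , here eq) with fold⁻ (<⇒≤ x<2h) eq
  ... | inj₁ x≡r = here x≡r
  ... | inj₂ x≡2h∸r = there (here x≡2h∸r)
  from (x<2h , there (here eq)) with fold⁻ (<⇒≤ x<2h) eq
  ... | inj₁ x≡h = there (there (here x≡h))
  ... | inj₂ x≡2h∸h = there (there (here (trans x≡2h∸h 2h∸h≡h)))

-- Constraints that a prescribed degree puts on order and jumps.

neighbour : ∀ i → degree m R i ≡ suc d → ∃[ j ] Adj m R i j
neighbour {m} {R} i eq with filter (adj? m R i) (allFin m) in nbrs
... | j ∷ _ = j , proj₂ (∈-filter⁻ (adj? m R i) {xs = allFin m} (subst (j ∈_) (sym nbrs) (here refl)))

degree≤order : ∀ (i : Fin m) → degree m R i ≤ m
degree≤order {m} {R} i =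
  ≤-trans (length-filter (adj? m R i) (allFin m)) (≤-reflexive (length-tabulate {n = m} (λ j → j)))

-- All neighbours of `zero` lie at the same circular distance from it, so any two distinct ones are
-- reflections of each other. A second and a third neighbour would both be the reflection of the
-- first. The hypothesis concerns members rather than length because `R` may contain repetitions.
subsingleton-not-cubic : 0 < m → (∀ {r s} → r ∈ R → s ∈ R → r ≡ s) → Regular 3 m R → ⊥
subsingleton-not-cubic {m@(suc _)} {R} 0<m subsingleton regular = three-neighbours _ refl
  (filter⁺ (adj? m R zero) (allFin⁺ m)) (regular zero)
  where
  nbrs = filter (adj? m R zero) (allFin m)
  same-fold : ∀ {x y} → x ∈ nbrs → y ∈ nbrs → fold m (toℕ y) ≡ fold m (toℕ x)
  -- `circDist m zero y` computes to `fold m (toℕ y)`.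
  same-fold x∈ y∈ = subsingleton
    (proj₂ (∈-filter⁻ (adj? m R zero) {xs = allFin m} y∈))
    (proj₂ (∈-filter⁻ (adj? m R zero) {xs = allFin m} x∈))
  opposite : ∀ {x y} → x ∈ nbrs → y ∈ nbrs → x ≢ y → toℕ y ≡ m ∸ toℕ x
  -- With `f` the common folded value, each of `x` and `y` is `f` or `m ∸ f`; equal choices would
  -- give `x ≡ y`.
  opposite {x} {y} x∈ y∈ x≢y with fold⁻ (toℕ≤n y) (same-fold x∈ y∈) | fold⁻ {r = fold m (toℕ x)} (toℕ≤n x) refl
  ... | inj₁ p | inj₁ q = contradiction (toℕ-injective (trans q (sym p))) x≢y
  ... | inj₂ p | inj₂ q = contradiction (toℕ-injective (trans q (sym p))) x≢y
  ... | inj₂ p | inj₁ q = trans p (cong (m ∸_) (sym q))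
  ... | inj₁ p | inj₂ q = trans p (trans (sym (m∸[m∸n]≡n (≤-trans (m⊓n≤m (toℕ x) _) (toℕ≤n x)))) (cong (m ∸_) (sym q)))
  -- The filtered list is generalised to `xs` so that its three entries can be exposed by matching.
  three-neighbours : ∀ xs → nbrs ≡ xs → Unique xs → length xs ≡ 3 → ⊥
  three-neighbours (x ∷ y ∷ z ∷ []) eq ((x≢y ∷ x≢z ∷ []) ∷ (y≢z ∷ []) ∷ _) refl =
    y≢z (toℕ-injective (trans
      (opposite (∈nbrs (here refl)) (∈nbrs (there (here refl))) x≢y)
      (sym (opposite (∈nbrs (here refl)) (∈nbrs (there (there (here refl)))) x≢z))))
    where
    ∈nbrs : ∀ {w} → w ∈ x ∷ y ∷ z ∷ [] → w ∈ nbrs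
    ∈nbrs {w} = subst (w ∈_) (sym eq)

-- Parity of the jumps, and the equivalence.

even-jump : ∀ {a b n x} → 2 ∤ b → 2 ∤ n → 2 ∣ x → x ∈ a ∷ b ∷ n ∷ [] → x ≡ a
even-jump 2∤b 2∤n 2∣x (here x≡a) = x≡a
even-jump 2∤b 2∤n 2∣x (there (here refl)) = contradiction 2∣x 2∤b
even-jump 2∤b 2∤n 2∣x (there (there (here refl))) = contradiction 2∣x 2∤n

theorem30 : (n a b : ℕ) → 0 < n → 2 ∤ n →
    a ≢ b → 0 < a → a < n → 0 < b → b < n → 2 ∤ b → 2 ∣ a →
    Connected (2 * n) (a ∷ b ∷ n ∷ []) →
    Regular 5 (2 * n) (a ∷ b ∷ n ∷ []) →
    AdmitsFactorization (2 * n) (a ∷ b ∷ n ∷ []) 3 2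
    ⇔ (∃[ p ] ∃[ q ] (0 < p × 0 < q × p > 2 × 1 < q × q < n × p ∣ a × q ∣ b × p * q ≡ 2 * n × gcd p q ≡ 1))
theorem30 n a b 0<n 2∤n a≢b 0<a a<n 0<b b<n 2∤b 2∣a _ _ = mk⇔ to from
  where
  T = a ∷ b ∷ n ∷ []

  to : AdmitsFactorization (2 * n) T 3 2 →
       ∃[ p ] ∃[ q ] (0 < p × 0 < q × p > 2 × 1 < q × q < n × p ∣ a × q ∣ b × p * q ≡ 2 * n × gcd p q ≡ 1)
  to (p@(suc _) , q@(suc _) , R , S , 1<p , 1<q , coprime , pq≡2n , _ , _ , T∼ , cubic , cycle) =
    p , q , <⇒≤ 1<p , <⇒≤ 1<q , p>2 , 1<q , q<n , p∣a , q∣b , pq≡2n , coprime⇒gcd≡1 coprime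
    where
    qR⊆T : ∀ {r} → r ∈ R → q * r ∈ T
    qR⊆T r∈R = Equivalence.to T∼ (∈-++⁺ˡ (∈-map⁺ (q *_) r∈R))
    2∣p : 2 ∣ p
    2∣p with euclidsLemma p q prime[2] (subst (2 ∣_) (sym pq≡2n) (m∣m*n n))
    ... | inj₁ 2∣p = 2∣p
    ... | inj₂ 2∣q = contradiction cubic (subsingleton-not-cubic (<⇒≤ 1<p) λ {r} {s} r∈R s∈R →
            *-cancelˡ-≡ r s q (trans (qr≡a r∈R) (sym (qr≡a s∈R))))
      where
      qr≡a : ∀ {r} → r ∈ R → q * r ≡ a
      qr≡a {r} r∈R = even-jump 2∤b 2∤n (∣-trans 2∣q (m∣m*n r)) (qR⊆T r∈R)
    p>2 : p > 2
    -- A degree counts vertices, so degree 3 forces `3 ≤ p`.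
    p>2 = subst (_≤ p) (cubic zero) (degree≤order {p} {R} zero)
    q<n : q < n
    q<n = *-cancelˡ-< 2 q n (subst (2 * q <_) pq≡2n (*-monoˡ-< q p>2))
    p∣a : p ∣ a
    -- Any jump in `S` serves; positive degree supplies one, as the distance from `zero` to a
    -- neighbour. Its multiple by the even `p` must be `a`.
    p∣a with j , s∈S ← neighbour {q} {S} zero (cycle zero) =
      subst (p ∣_)
        (even-jump 2∤b 2∤n (∣-trans 2∣p (m∣m*n s))
          (Equivalence.to T∼ (∈-++⁺ʳ (map (q *_) R) (∈-map⁺ (p *_) s∈S))))
        (m∣m*n s)
      where s = circDist q zero j
    q∣b : q ∣ b
    q∣b with ∈-++⁻ (map (q *_) R) (Equivalence.from T∼ (there (here refl)))
    ... | inj₁ b∈qR with r , _ , refl ← ∈-map⁻ (q *_) b∈qR = m∣m*n r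
    ... | inj₂ b∈pS with s , _ , refl ← ∈-map⁻ (p *_) b∈pS = contradiction (∣-trans 2∣p (m∣m*n s)) 2∤b

  from : ∃[ p ] ∃[ q ] (0 < p × 0 < q × p > 2 × 1 < q × q < n × p ∣ a × q ∣ b × p * q ≡ 2 * n × gcd p q ≡ 1) →
         AdmitsFactorization (2 * n) T 3 2
  from (p , q , 0<p , 0<q , p>2 , 1<q , q<n , divides s a≡sp , divides r b≡rq , pq≡2n , gcd≡1)
    with euclidsLemma p q prime[2] (subst (2 ∣_) (sym pq≡2n) (m∣m*n n))
  -- As a divisor of the odd `b`, the factor `q` is odd, so the factor 2 sits in `p` and `h` is half
  -- of `p`.
  ... | inj₂ 2∣q = contradiction (∣-trans 2∣q (divides r b≡rq)) 2∤b
  ... | inj₁ (divides h p≡h2) =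
    p , q , r ∷ h ∷ [] , s ∷ [] , <⇒≤ p>2 , 1<q , gcd≡1⇒coprime gcd≡1 , pq≡2n
    , (0<r , subst (2 * r ≤_) (sym p≡2h) (*-monoʳ-≤ 2 (<⇒≤ r<h)))
      ∷ (≤-<-trans z≤n r<h , ≤-reflexive (sym p≡2h)) ∷ []
    , (0<s , <⇒≤ 2s<q) ∷ []
    , mk⇔ ⊆T T⊆
    , subst (λ m → Regular 3 m (r ∷ h ∷ [])) (sym p≡2h) (regular-with-half 0<r r<h)
    , regular-singleton 0<s 2s<q
    where
    instance
      q≢0 : NonZero q
      q≢0 = >-nonZero 0<q
    p≡2h : p ≡ 2 * h
    p≡2h = trans p≡h2 (*-comm h 2)
    qr≡b : q * r ≡ b
    qr≡b = trans (*-comm q r) (sym b≡rq)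
    ps≡a : p * s ≡ a
    ps≡a = trans (*-comm p s) (sym a≡sp)
    qh≡n : q * h ≡ n
    qh≡n = *-cancelˡ-≡ (q * h) n 2 (begin
      2 * (q * h) ≡⟨ cong (2 *_) (*-comm q h) ⟩
      2 * (h * q) ≡⟨ *-assoc 2 h q ⟨
      2 * h * q   ≡⟨ cong (_* q) p≡2h ⟨
      p * q       ≡⟨ pq≡2n ⟩
      2 * n       ∎)
      where open ≡-Reasoning
    positive : ∀ k x → 0 < k * x → 0 < x
    positive k zero 0<k*0 = contradiction (*-zeroʳ k) (>⇒≢ 0<k*0)
    positive k (suc x) _ = s≤s z≤n
    0<r : 0 < r
    0<r = positive q r (subst (0 <_) (sym qr≡b) 0<b)
    0<s : 0 < s
    0<s = positive p s (subst (0 <_) (sym ps≡a) 0<a)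
    r<h : r < h
    -- This is `b < n` divided by `q`.
    r<h = *-cancelˡ-< q r h (subst₂ _<_ (sym qr≡b) (sym qh≡n) b<n)
    2s<q : 2 * s < q
    -- This is `a < n` divided by `h`; its strictness gives `C_q(S)` degree 2 rather than 1.
    2s<q = *-cancelˡ-< h (2 * s) q (subst₂ _<_ a≡h[2s] n≡hq a<n)
      where
      a≡h[2s] : a ≡ h * (2 * s)
      a≡h[2s] = trans (sym ps≡a) (trans (cong (_* s) p≡h2) (*-assoc h 2 s))
      n≡hq : n ≡ h * q
      n≡hq = trans (sym qh≡n) (*-comm q h)
    -- The union of `qR` and `pS` computes to this explicit list.
    ⊆T : ∀ {x} → x ∈ q * r ∷ q * h ∷ p * s ∷ [] → x ∈ T
    ⊆T (here x≡) = there (here (trans x≡ qr≡b))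
    ⊆T (there (here x≡)) = there (there (here (trans x≡ qh≡n)))
    ⊆T (there (there (here x≡))) = here (trans x≡ ps≡a)
    T⊆ : ∀ {x} → x ∈ T → x ∈ q * r ∷ q * h ∷ p * s ∷ []
    T⊆ (here x≡) = there (there (here (trans x≡ (sym ps≡a))))
    T⊆ (there (here x≡)) = here (trans x≡ (sym qr≡b))
    T⊆ (there (there (here x≡))) = there (here (trans x≡ (sym qh≡n)))
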